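{- Let $m > 1$ be an integer and $a$ a non-negative integer. Then the congruence class of $a$ modulo $m$ contains infinitely many $\pi/4$-congruent numbers that are pairwise inequivalent modulo $(\mathbb{Q}^\times)^2$. The same statement holds for $3\pi/4$-congruent numbers.
   Context: For $\theta \in \{\pi/4,3\pi/4\}$, a positive integer $n$ is $\theta$-congruent if there exist positive rationals $a,b,c$ such that the triangle with sides $a$, $b\sqrt2$, $c$ has angle $\theta$ opposite $c$ and area $n$; equivalently $ab = 2n$ and $c^2 = a^2+2b^2-2ab$ (for $\theta = \pi/4$), resp. $c^2 = a^2+2b^2+2ab$ (for $\theta=3\pi/4$). -}

module Defs where

open import Data.Integer using (+_) renaming (_-_ to _-ℤ_)
open import Data.Integer.Divisibility using () renaming (_∣_ to _∣ℤ_)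
open import Data.Nat using (ℕ) renaming (_<_ to _<ℕ_)
open import Data.Product using (∃-syntax; _×_)
open import Data.Rational using (ℚ; 0ℚ; _+_; _-_; _*_; _<_; _/_)
open import Relation.Binary.PropositionalEquality using (_≡_; _≢_)

ℕ→ℚ : ℕ → ℚ
ℕ→ℚ n = + n / 1

2ℚ : ℚ
2ℚ = ℕ→ℚ 2

data Angle : Set where
  π/4 3π/4 : Angle

-- Right-hand side of the law of cosines c² = a² + (b√2)² - 2·a·(b√2)·cos θ,
-- where cos (π/4) = √2/2 and cos (3π/4) = - √2/2.
squareOfOppositeSide : Angle → ℚ → ℚ → ℚ
squareOfOppositeSide π/4  a b = a * a + 2ℚ * (b * b) - 2ℚ * (a * b)
squareOfOppositeSide 3π/4 a b = a * a + 2ℚ * (b * b) + 2ℚ * (a * b)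

-- The triangle with sides a, b√2, c has angle θ opposite c and area n.
-- For both angles sin θ = √2/2, so the area ½·a·(b√2)·sin θ equals ab/2.
record Triangle (θ : Angle) (n : ℕ) (a b c : ℚ) : Set where
  field
    a-positive : 0ℚ < a
    b-positive : 0ℚ < b
    c-positive : 0ℚ < c
    area       : a * b ≡ 2ℚ * ℕ→ℚ n
    angle      : c * c ≡ squareOfOppositeSide θ a b

IsCongruentNumber : Angle → ℕ → Set
IsCongruentNumber θ n = 0 <ℕ n × (∃[ a ] ∃[ b ] ∃[ c ] Triangle θ n a b c)

infix 4 _≡_mod_

_≡_mod_ : ℕ → ℕ → ℕ → Set
x ≡ y mod m = + m ∣ℤ (+ x -ℤ + y)

infix 4 _∼□_

-- Equality of classes modulo (ℚ^×)²; meaningful for nonzero arguments.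
_∼□_ : ℚ → ℚ → Set
x ∼□ y = ∃[ q ] (q ≢ 0ℚ × x ≡ (q * q) * y)

{-# OPTIONS --safe #-}

-- Replacing a by a + m, assume a > 0, and put b = am². For every q the number f = q⁴ ± 2bq² - b²
-- (+ for π/4, - for 3π/4) makes af the area of the triangle with sides f/(mq), √2·2bq²/(mq) and
-- (q⁴ + b²)/(mq). If q ≡ 1 mod b, then f ≡ 1 mod b, so af ≡ a mod m, and f is prime to b, hence to q.
-- The recursion qᵢ₊₁ = qᵢfᵢ keeps q ≡ 1 mod b and makes the fᵢ pairwise coprime. Equivalence of
-- afᵢ and afⱼ modulo squares would then force fᵢ to be a square; but f = (q² ± b)² - 2b² lies strictly
-- between the consecutive squares (q² ± b - 1)² and (q² ± b)².
module Submission where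

open import Defs
open import Data.Integer using (+_; ∣_∣)
import Data.Integer as ℤ
import Data.Integer.Properties as ℤₚ
open import Data.Nat using (ℕ; zero; suc; _+_; _*_; _∸_; _≤_; _<_; NonZero; pred; s≤s; z<s; >-nonZero; >-nonZero⁻¹)
open import Data.Nat.Coprimality using (Coprime; coprime-divisor) renaming (sym to coprime-sym; recompute to coprime-recompute)
open import Data.Nat.Divisibility using (_∣_; divides; ∣-trans; ∣-antisym; ∣1⇒≡1; ∣m+n∣m⇒∣n; ∣m⇒∣m*n; n∣m*n)
open import Data.Nat.Properties
open import Data.Nat.Tactic.RingSolver using (solve-∀)
open import Data.Product using (Σ-syntax; ∃-syntax; _×_; _,_)
open import Data.Rational using (ℚ; mkℚ; 0ℚ; 1ℚ; toℚᵘ; Positive) renaming (_<_ to _<ℚ_; _+_ to _+ℚ_; _*_ to _*ℚ_; _-_ to _-ℚ_; 1/_ to 1/ℚ_)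
import Data.Rational.Properties as ℚₚ
open import Data.Rational.Solver using (module +-*-Solver)
open import Data.Rational.Unnormalised using (mkℚᵘ; *≡*) renaming (_≃_ to _≃ᵘ_; _+_ to _+ᵘ_; _*_ to _*ᵘ_)
import Data.Rational.Unnormalised.Properties as ℚᵘₚ
open import Data.Sum using (inj₁; inj₂)
open import Relation.Binary.Definitions using (tri<; tri≈; tri>)
open import Relation.Binary.PropositionalEquality using (_≡_; _≢_; refl; sym; trans; cong; cong₂; subst; module ≡-Reasoning)
open import Relation.Nullary using (¬_; contradiction)

-- Coprime numbers and squares

coprime-* : ∀ {m n o} → Coprime m n → Coprime m o → Coprime m (n * o)
coprime-* m⊥n m⊥o (d∣m , d∣no) =
  m⊥o (d∣m , coprime-divisor (λ (e∣d , e∣n) → m⊥n (∣-trans e∣d d∣m , e∣n)) d∣no)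

coprime-square : ∀ {m n} → Coprime m n → Coprime (m * m) (n * n)
coprime-square m⊥n = coprime-* mm⊥n mm⊥n
  where mm⊥n = coprime-sym (coprime-* (coprime-sym m⊥n) (coprime-sym m⊥n))

-- Each of `f` and `x * x` divides the other: `f` divides `x * x * g` and is prime to `g`, while
-- `x * x` divides `f * (y * y)` and is prime to `y * y`.
coprime-same-class⇒square : ∀ {f g x y} → Coprime f g → Coprime x y →
  f * (y * y) ≡ x * x * g → f ≡ x * x
coprime-same-class⇒square {f} {g} {x} {y} f⊥g x⊥y eq = ∣-antisym
  (coprime-divisor f⊥g (divides (y * y) (trans (*-comm g (x * x)) (trans (sym eq) (*-comm f (y * y))))))
  (coprime-divisor (coprime-square x⊥y) (divides g (trans (*-comm (y * y) f) (trans eq (*-comm (x * x) g)))))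

square-cancel-< : ∀ m n → m * m < n * n → m < n
square-cancel-< m n m²<n² = ≰⇒> (λ n≤m → <⇒≱ m²<n² (*-mono-≤ n≤m n≤m))

no-square-between : ∀ w x → w * w < x * x → ¬ (x * x < suc w * suc w)
no-square-between w x w²<x² x²<[1+w]² =
  <⇒≱ (square-cancel-< w x w²<x²) (m<1+n⇒m≤n (square-cancel-< x (suc w) x²<[1+w]²))

-- Natural numbers in ℚ

-- `+ n / 1` is normalised by a gcd and does not reduce for a variable `n`. Identities are therefore
-- checked on the unnormalised fraction with denominator 1 and carried back by injectivity of
-- `toℚᵘ`.
toℚᵘ-ℕ→ℚ : ∀ n → toℚᵘ (ℕ→ℚ n) ≃ᵘ mkℚᵘ (+ n) 0
toℚᵘ-ℕ→ℚ n = ℚₚ.toℚᵘ-fromℚᵘ (mkℚᵘ (+ n) 0)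

ℕ→ℚ-+ : ∀ m n → ℕ→ℚ (m + n) ≡ ℕ→ℚ m +ℚ ℕ→ℚ n
ℕ→ℚ-+ m n = ℚₚ.toℚᵘ-injective (begin
  toℚᵘ (ℕ→ℚ (m + n))               ≈⟨ toℚᵘ-ℕ→ℚ (m + n) ⟩
  mkℚᵘ (+ (m + n)) 0               ≈⟨ *≡* (cong (ℤ._* + 1) (sym (cong₂ ℤ._+_ (ℤₚ.*-identityʳ (+ m)) (ℤₚ.*-identityʳ (+ n))))) ⟩
  mkℚᵘ (+ m) 0 +ᵘ mkℚᵘ (+ n) 0     ≈⟨ ℚᵘₚ.+-cong (toℚᵘ-ℕ→ℚ m) (toℚᵘ-ℕ→ℚ n) ⟨
  toℚᵘ (ℕ→ℚ m) +ᵘ toℚᵘ (ℕ→ℚ n)     ≈⟨ ℚₚ.toℚᵘ-homo-+ (ℕ→ℚ m) (ℕ→ℚ n) ⟨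
  toℚᵘ (ℕ→ℚ m +ℚ ℕ→ℚ n)            ∎)
  where open ℚᵘₚ.≃-Reasoning

ℕ→ℚ-* : ∀ m n → ℕ→ℚ (m * n) ≡ ℕ→ℚ m *ℚ ℕ→ℚ n
ℕ→ℚ-* m n = ℚₚ.toℚᵘ-injective (begin
  toℚᵘ (ℕ→ℚ (m * n))               ≈⟨ toℚᵘ-ℕ→ℚ (m * n) ⟩
  mkℚᵘ (+ (m * n)) 0               ≈⟨ *≡* (cong (ℤ._* + 1) (ℤₚ.pos-* m n)) ⟩
  mkℚᵘ (+ m) 0 *ᵘ mkℚᵘ (+ n) 0     ≈⟨ ℚᵘₚ.*-cong (toℚᵘ-ℕ→ℚ m) (toℚᵘ-ℕ→ℚ n) ⟨
  toℚᵘ (ℕ→ℚ m) *ᵘ toℚᵘ (ℕ→ℚ n)     ≈⟨ ℚₚ.toℚᵘ-homo-* (ℕ→ℚ m) (ℕ→ℚ n) ⟨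
  toℚᵘ (ℕ→ℚ m *ℚ ℕ→ℚ n)            ∎)
  where open ℚᵘₚ.≃-Reasoning

ℕ→ℚ-positive : ∀ n .{{_ : NonZero n}} → Positive (ℕ→ℚ n)
ℕ→ℚ-positive n = ℚₚ.normalize-pos n 1

-- The witnesses are the numerator and denominator of the rational factor in lowest terms. Absolute
-- values remove the sign, which the square does not see.
∼□⇒coprime-witness : ∀ {m n} → ℕ→ℚ m ∼□ ℕ→ℚ n →
  ∃[ x ] ∃[ y ] Coprime x y × m * (y * y) ≡ x * x * n
∼□⇒coprime-witness {m} {n} (p@(mkℚ u d-1 u⊥d) , _ , eq) =
  -- The coprimality stored in a rational is irrelevant, so it has to be recomputed before it can be
  -- returned.
  ∣ u ∣ , d , coprime-recompute u⊥d , (begin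
    -- The extra factor 1 is the denominator of `n` in the unnormalised product of `m≃`.
    m * (d * d)                        ≡⟨ cong (m *_) (sym (*-identityʳ (d * d))) ⟩
    m * (d * d * 1)                    ≡⟨⟩
    ∣ + m ∣ * ∣ + (d * d * 1) ∣        ≡⟨ sym (ℤₚ.∣i*j∣≡∣i∣*∣j∣ (+ m) (+ (d * d * 1))) ⟩
    ∣ + m ℤ.* + (d * d * 1) ∣          ≡⟨ cong ∣_∣ (ℚᵘₚ.drop-*≡* m≃) ⟩
    ∣ u ℤ.* u ℤ.* + n ℤ.* + 1 ∣        ≡⟨ cong ∣_∣ (ℤₚ.*-identityʳ (u ℤ.* u ℤ.* + n)) ⟩
    ∣ u ℤ.* u ℤ.* + n ∣                ≡⟨ ℤₚ.∣i*j∣≡∣i∣*∣j∣ (u ℤ.* u) (+ n) ⟩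
    ∣ u ℤ.* u ∣ * n                    ≡⟨ cong (_* n) (ℤₚ.∣i*j∣≡∣i∣*∣j∣ u u) ⟩
    ∣ u ∣ * ∣ u ∣ * n                  ∎)
  where
  open ≡-Reasoning
  d = suc d-1
  m≃ : mkℚᵘ (+ m) 0 ≃ᵘ mkℚᵘ u d-1 *ᵘ mkℚᵘ u d-1 *ᵘ mkℚᵘ (+ n) 0
  m≃ = ℚᵘₚ.≃-trans (ℚᵘₚ.≃-sym (toℚᵘ-ℕ→ℚ m))
      (ℚᵘₚ.≃-trans (ℚₚ.toℚᵘ-cong eq)
      (ℚᵘₚ.≃-trans (ℚₚ.toℚᵘ-homo-* (p *ℚ p) (ℕ→ℚ n))
      (ℚᵘₚ.*-cong (ℚₚ.toℚᵘ-homo-* p p) (toℚᵘ-ℕ→ℚ n))))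

-- The quartic form and its triangles

-- f = q⁴ ± 2bq² - b², with Q = q².
QuarticValue : Angle → (b Q f : ℕ) → Set
QuarticValue π/4  b Q f = f + b * b ≡ Q * (Q + 2 * b)
QuarticValue 3π/4 b Q f = f + (b * b + 2 * b * Q) ≡ Q * Q

-- (f ∓ 2bQ)² + (2bQ)² = (Q² - b²)² + (2bQ)² = (Q² + b²)².
quartic-pythagoras : ∀ θ b Q f → QuarticValue θ b Q f → ∀ r →
  let ℓ = ℕ→ℚ (Q * Q + b * b) *ℚ r in
  ℓ *ℚ ℓ ≡ squareOfOppositeSide θ (ℕ→ℚ f *ℚ r) (ℕ→ℚ (2 * (b * Q)) *ℚ r)
quartic-pythagoras θ b Q f v r = trans (cong (λ z → (z *ℚ r) *ℚ (z *ℚ r)) C≡) (go θ v)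
  where
  open +-*-Solver
  b̂ = ℕ→ℚ b
  Q̂ = ℕ→ℚ Q
  C≡ : ℕ→ℚ (Q * Q + b * b) ≡ Q̂ *ℚ Q̂ +ℚ b̂ *ℚ b̂
  C≡ = trans (ℕ→ℚ-+ (Q * Q) (b * b)) (cong₂ _+ℚ_ (ℕ→ℚ-* Q Q) (ℕ→ℚ-* b b))
  D≡ : ℕ→ℚ (2 * (b * Q)) ≡ 2ℚ *ℚ (b̂ *ℚ Q̂)
  -- The factor 2 is split off here because `squareOfOppositeSide` is compared with a polynomial in
  -- `b̂`, `Q̂` and `r` only.
  D≡ = trans (ℕ→ℚ-* 2 (b * Q)) (cong (2ℚ *ℚ_) (ℕ→ℚ-* b Q))
  -- `QuarticValue` is additive, avoiding truncated subtraction in ℕ; over ℚ it can be solved for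
  -- `f`.
  move : ∀ {x y z} → x +ℚ y ≡ z → x ≡ z -ℚ y
  move {x} {y} refl = solve 2 (λ x y → x := (x :+ y) :- y) refl x y
  go : ∀ θ → QuarticValue θ b Q f →
    ((Q̂ *ℚ Q̂ +ℚ b̂ *ℚ b̂) *ℚ r) *ℚ ((Q̂ *ℚ Q̂ +ℚ b̂ *ℚ b̂) *ℚ r)
      ≡ squareOfOppositeSide θ (ℕ→ℚ f *ℚ r) (ℕ→ℚ (2 * (b * Q)) *ℚ r)
  go π/4 v = trans
    (solve 3 (λ b Q r →
      let a′ = (Q :* (Q :+ con 2ℚ :* b) :- b :* b) :* r
          b′ = (con 2ℚ :* (b :* Q)) :* r
          c′ = (Q :* Q :+ b :* b) :* r
      in c′ :* c′ := a′ :* a′ :+ con 2ℚ :* (b′ :* b′) :- con 2ℚ :* (a′ :* b′)) refl b̂ Q̂ r)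
    (sym (cong₂ (λ s t → squareOfOppositeSide π/4 (s *ℚ r) (t *ℚ r)) f≡ D≡))
    where
    f≡ : ℕ→ℚ f ≡ Q̂ *ℚ (Q̂ +ℚ 2ℚ *ℚ b̂) -ℚ b̂ *ℚ b̂
    f≡ = move (begin
      ℕ→ℚ f +ℚ b̂ *ℚ b̂           ≡⟨ cong (ℕ→ℚ f +ℚ_) (ℕ→ℚ-* b b) ⟨
      ℕ→ℚ f +ℚ ℕ→ℚ (b * b)      ≡⟨ ℕ→ℚ-+ f (b * b) ⟨
      ℕ→ℚ (f + b * b)           ≡⟨ cong ℕ→ℚ v ⟩
      ℕ→ℚ (Q * (Q + 2 * b))     ≡⟨ ℕ→ℚ-* Q (Q + 2 * b) ⟩
      Q̂ *ℚ ℕ→ℚ (Q + 2 * b)      ≡⟨ cong (Q̂ *ℚ_) (ℕ→ℚ-+ Q (2 * b)) ⟩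
      Q̂ *ℚ (Q̂ +ℚ ℕ→ℚ (2 * b))   ≡⟨ cong (λ z → Q̂ *ℚ (Q̂ +ℚ z)) (ℕ→ℚ-* 2 b) ⟩
      Q̂ *ℚ (Q̂ +ℚ 2ℚ *ℚ b̂)       ∎)
      where open ≡-Reasoning
  go 3π/4 v = trans
    (solve 3 (λ b Q r →
      let a′ = (Q :* Q :- (b :* b :+ con 2ℚ :* b :* Q)) :* r
          b′ = (con 2ℚ :* (b :* Q)) :* r
          c′ = (Q :* Q :+ b :* b) :* r
      in c′ :* c′ := a′ :* a′ :+ con 2ℚ :* (b′ :* b′) :+ con 2ℚ :* (a′ :* b′)) refl b̂ Q̂ r)
    (sym (cong₂ (λ s t → squareOfOppositeSide 3π/4 (s *ℚ r) (t *ℚ r)) f≡ D≡))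
    where
    f≡ : ℕ→ℚ f ≡ Q̂ *ℚ Q̂ -ℚ (b̂ *ℚ b̂ +ℚ 2ℚ *ℚ b̂ *ℚ Q̂)
    f≡ = move (begin
      ℕ→ℚ f +ℚ (b̂ *ℚ b̂ +ℚ 2ℚ *ℚ b̂ *ℚ Q̂)                 ≡⟨ cong (λ z → ℕ→ℚ f +ℚ (b̂ *ℚ b̂ +ℚ z *ℚ Q̂)) (ℕ→ℚ-* 2 b) ⟨
      ℕ→ℚ f +ℚ (b̂ *ℚ b̂ +ℚ ℕ→ℚ (2 * b) *ℚ Q̂)             ≡⟨ cong (ℕ→ℚ f +ℚ_) (cong₂ _+ℚ_ (ℕ→ℚ-* b b) (ℕ→ℚ-* (2 * b) Q)) ⟨
      ℕ→ℚ f +ℚ (ℕ→ℚ (b * b) +ℚ ℕ→ℚ (2 * b * Q))         ≡⟨ cong (ℕ→ℚ f +ℚ_) (ℕ→ℚ-+ (b * b) (2 * b * Q)) ⟨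
      ℕ→ℚ f +ℚ ℕ→ℚ (b * b + 2 * b * Q)                  ≡⟨ ℕ→ℚ-+ f (b * b + 2 * b * Q) ⟨
      ℕ→ℚ (f + (b * b + 2 * b * Q))                     ≡⟨ cong ℕ→ℚ v ⟩
      ℕ→ℚ (Q * Q)                                       ≡⟨ ℕ→ℚ-* Q Q ⟩
      Q̂ *ℚ Q̂                                            ∎)
      where open ≡-Reasoning

-- The choice b = am² gives bq² = a(mq)². The unscaled sides f and 2bq² thus have product 2af(mq)²,
-- and scaling both by `r` = 1/(mq) leaves 2af, twice the required area.
quartic-congruent : ∀ θ a m q f .{{_ : NonZero a}} .{{_ : NonZero m}} .{{_ : NonZero q}} .{{_ : NonZero f}} →
  QuarticValue θ (a * (m * m)) (q * q) f → IsCongruentNumber θ (a * f)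
quartic-congruent θ a m q f v =
  >-nonZero⁻¹ (a * f) {{m*n≢0 a f}} ,
  ℕ→ℚ f *ℚ r , ℕ→ℚ (2 * (b * Q)) *ℚ r , ℕ→ℚ (Q * Q + b * b) *ℚ r , record
    { a-positive = scaled-positive f
    ; b-positive = scaled-positive (2 * (b * Q)) {{m*n≢0 2 (b * Q)}}
    ; c-positive = scaled-positive (Q * Q + b * b)
    ; area       = area
    ; angle      = quartic-pythagoras θ b Q f v r
    }
  where
  b = a * (m * m)
  Q = q * q
  instance
    mq≢0 : NonZero (m * q)
    mq≢0 = m*n≢0 m q
    mm≢0 : NonZero (m * m)
    mm≢0 = m*n≢0 m m
    Q≢0 : NonZero (q * q)
    Q≢0 = m*n≢0 q q
    b≢0 : NonZero (a * (m * m))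
    b≢0 = m*n≢0 a (m * m)
    bQ≢0 : NonZero (a * (m * m) * (q * q))
    bQ≢0 = m*n≢0 b Q
    C≢0 : NonZero (q * q * (q * q) + a * (m * m) * (a * (m * m)))
    C≢0 = >-nonZero (≤-trans (>-nonZero⁻¹ (Q * Q) {{m*n≢0 Q Q}}) (m≤m+n (Q * Q) (b * b)))
  mq>0 : Positive (ℕ→ℚ (m * q))
  mq>0 = ℕ→ℚ-positive (m * q)
  r : ℚ
  r = (1/ℚ ℕ→ℚ (m * q)) {{ℚₚ.pos⇒nonZero (ℕ→ℚ (m * q)) {{mq>0}}}}
  r>0 : Positive r
  r>0 = ℚₚ.1/pos⇒pos (ℕ→ℚ (m * q)) {{mq>0}}
  scaled-positive : ∀ n .{{_ : NonZero n}} → 0ℚ <ℚ ℕ→ℚ n *ℚ r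
  scaled-positive n = ℚₚ.positive⁻¹ (ℕ→ℚ n *ℚ r) {{ℚₚ.pos*pos⇒pos (ℕ→ℚ n) {{ℕ→ℚ-positive n}} r {{r>0}}}}
  Dr≡1 : ℕ→ℚ (m * q) *ℚ r ≡ 1ℚ
  Dr≡1 = ℚₚ.*-inverseʳ (ℕ→ℚ (m * q)) {{ℚₚ.pos⇒nonZero (ℕ→ℚ (m * q)) {{mq>0}}}}
  expand : ∀ a m q → 2 * (a * (m * m) * (q * q)) ≡ 2 * a * (m * q * (m * q))
  expand = solve-∀
  D : ℚ
  D = ℕ→ℚ (m * q)
  side-b : ℕ→ℚ (2 * (b * Q)) ≡ 2ℚ *ℚ ℕ→ℚ a *ℚ (D *ℚ D)
  side-b = trans (cong ℕ→ℚ (expand a m q))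
    (trans (ℕ→ℚ-* (2 * a) (m * q * (m * q))) (cong₂ _*ℚ_ (ℕ→ℚ-* 2 a) (ℕ→ℚ-* (m * q) (m * q))))
  area : (ℕ→ℚ f *ℚ r) *ℚ (ℕ→ℚ (2 * (b * Q)) *ℚ r) ≡ 2ℚ *ℚ ℕ→ℚ (a * f)
  area = begin
    (ℕ→ℚ f *ℚ r) *ℚ (ℕ→ℚ (2 * (b * Q)) *ℚ r)           ≡⟨ cong (λ z → (ℕ→ℚ f *ℚ r) *ℚ (z *ℚ r)) side-b ⟩
    (ℕ→ℚ f *ℚ r) *ℚ (2ℚ *ℚ ℕ→ℚ a *ℚ (D *ℚ D) *ℚ r)     ≡⟨ solve 5 (λ f r t a d → (f :* r) :* (t :* a :* (d :* d) :* r) := (t :* (a :* f)) :* ((d :* r) :* (d :* r))) refl (ℕ→ℚ f) r 2ℚ (ℕ→ℚ a) D ⟩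
    (2ℚ *ℚ (ℕ→ℚ a *ℚ ℕ→ℚ f)) *ℚ ((D *ℚ r) *ℚ (D *ℚ r))  ≡⟨ cong₂ (λ s t → (2ℚ *ℚ s) *ℚ (t *ℚ t)) (sym (ℕ→ℚ-* a f)) Dr≡1 ⟩
    (2ℚ *ℚ ℕ→ℚ (a * f)) *ℚ 1ℚ                           ≡⟨ ℚₚ.*-identityʳ _ ⟩
    2ℚ *ℚ ℕ→ℚ (a * f)                                  ∎
    where
    open ≡-Reasoning
    open +-*-Solver

-- A Euclid-type sequence of pairwise coprime values

module CoprimeValues (θ : Angle) (β : ℕ) where

  b : ℕ
  b = suc β

  -- The shift `1 + y` excludes q = 1, for which the excess would be -1 (for `π/4`) or -3 (for
  -- `3π/4`) instead of a natural number.
  base : ℕ → ℕ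
  base y = 1 + b * (1 + y)

  -- With q = base y, the excess h is determined by q² ± b = 1 + b(2 + h).
  excess : Angle → ℕ → ℕ
  excess π/4  y = 1 + 2 * y + b * ((1 + y) * (1 + y))
  excess 3π/4 y = 2 * y + β + b * (2 * y + y * y)

  -- value y = (1 + w)² - 2b², where w = lowerRoot y.
  lowerRoot : ℕ → ℕ
  lowerRoot y = b * (2 + excess θ y)

  -- This is ((1 + b(2 + h))² - 2b² - 1)/b expanded, with `2 + 4 * h + h * h` standing for (2 + h)²
  -- - 2. Splitting off the 2 from the excess is what keeps every coefficient non-negative.
  cofactor : ℕ → ℕ
  cofactor y = 2 * (2 + h) + b * (2 + 4 * h + h * h)
    where h = excess θ y

  value : ℕ → ℕ
  value y = 1 + b * cofactor y

  value+2b² : ∀ y → value y + 2 * (b * b) ≡ suc (lowerRoot y) * suc (lowerRoot y)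
  value+2b² y = identity b (excess θ y)
    where
    identity : ∀ b h → 1 + b * (2 * (2 + h) + b * (2 + 4 * h + h * h)) + 2 * (b * b)
      ≡ (1 + b * (2 + h)) * (1 + b * (2 + h))
    identity = solve-∀

  -- By the choice of `excess`, X = Q + b for `π/4` and Q = X + b for `3π/4`. Substituting this in f
  -- + 2b² = X² and comparing squares gives the quartic.
  quarticValue : ∀ y → QuarticValue θ b (base y * base y) (value y)
  quarticValue y = go θ refl
    where
    open ≡-Reasoning
    f = value y
    X = suc (lowerRoot y)
    Q = base y * base y
    -- Matching on the equation specialises the module parameter `θ`, so that `excess θ` inside `X`
    -- and `f` reduces.
    go : ∀ θ′ → θ ≡ θ′ → QuarticValue θ′ b Q f
    go π/4 refl = +-cancelʳ-≡ (b * b) _ _ (begin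
      f + b * b + b * b           ≡⟨ eq₁ f b ⟩
      f + 2 * (b * b)             ≡⟨ value+2b² y ⟩
      X * X                       ≡⟨ cong₂ _*_ X≡ X≡ ⟩
      (Q + b) * (Q + b)           ≡⟨ eq₂ Q b ⟩
      Q * (Q + 2 * b) + b * b     ∎)
      where
      eq₁ : ∀ f b → f + b * b + b * b ≡ f + 2 * (b * b)
      eq₁ = solve-∀
      eq₂ : ∀ Q b → (Q + b) * (Q + b) ≡ Q * (Q + 2 * b) + b * b
      eq₂ = solve-∀
      eq₃ : ∀ b y → 1 + b * (2 + (1 + 2 * y + b * ((1 + y) * (1 + y))))
        ≡ (1 + b * (1 + y)) * (1 + b * (1 + y)) + b
      eq₃ = solve-∀
      X≡ : X ≡ Q + b
      X≡ = eq₃ b y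
    go 3π/4 refl = begin
      f + (b * b + 2 * b * Q)               ≡⟨ cong (λ z → f + (b * b + 2 * b * z)) Q≡ ⟩
      f + (b * b + 2 * b * (X + b))         ≡⟨ eq₁ f b X ⟩
      f + 2 * (b * b) + (b * b + 2 * b * X) ≡⟨ cong (_+ (b * b + 2 * b * X)) (value+2b² y) ⟩
      X * X + (b * b + 2 * b * X)           ≡⟨ eq₂ X b ⟩
      (X + b) * (X + b)                     ≡⟨ sym (cong₂ _*_ Q≡ Q≡) ⟩
      Q * Q                                 ∎
      where
      eq₁ : ∀ f b X → f + (b * b + 2 * b * (X + b)) ≡ f + 2 * (b * b) + (b * b + 2 * b * X)
      eq₁ = solve-∀
      eq₂ : ∀ X b → X * X + (b * b + 2 * b * X) ≡ (X + b) * (X + b)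
      eq₂ = solve-∀
      eq₃ : ∀ β y → (1 + (1 + β) * (1 + y)) * (1 + (1 + β) * (1 + y))
        ≡ 1 + (1 + β) * (2 + (2 * y + β + (1 + β) * (2 * y + y * y))) + (1 + β)
      eq₃ = solve-∀
      Q≡ : Q ≡ X + b
      Q≡ = eq₃ β y

  -- Multiplied by 2b, this bounds 2b² by 2w for w = `lowerRoot y`. Since (1 + w)² exceeds w² by 2w
  -- + 1, subtracting 2b² from (1 + w)² stays above w².
  b≤2+excess : ∀ θ′ y → b ≤ 2 + excess θ′ y
  b≤2+excess π/4  y = ≤-trans (m≤m*n b ((1 + y) * (1 + y))) (m≤n+m _ (3 + 2 * y))
  b≤2+excess 3π/4 y = s≤s (≤-trans (m≤n+m β (1 + 2 * y)) (m≤m+n _ _))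

  value-nonsquare : ∀ y x → value y ≢ x * x
  value-nonsquare y x eq = no-square-between w x
    (subst (w * w <_) eq (+-cancelʳ-< (2 * (b * b)) _ _ (begin-strict
      w * w + 2 * (b * b)     ≤⟨ +-monoʳ-≤ (w * w) (*-monoʳ-≤ 2 (*-monoʳ-≤ b (b≤2+excess θ y))) ⟩
      w * w + 2 * w           <⟨ n<1+n _ ⟩
      1 + (w * w + 2 * w)     ≡⟨ square-suc w ⟩
      suc w * suc w           ≡⟨ value+2b² y ⟨
      value y + 2 * (b * b)   ∎)))
    (subst (_< suc w * suc w) eq (subst (value y <_) (value+2b² y) (m<m+n (value y) z<s)))
    where
    open ≤-Reasoning
    w = lowerRoot y
    square-suc : ∀ w → 1 + (w * w + 2 * w) ≡ (1 + w) * (1 + w)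
    square-suc = solve-∀

  value⊥b : ∀ y → Coprime (value y) b
  value⊥b y {d} (d∣f , d∣b) =
    ∣1⇒≡1 (∣m+n∣m⇒∣n (subst (d ∣_) (+-comm 1 (b * cofactor y)) d∣f) (∣m⇒∣m*n (cofactor y) d∣b))

  -- Every term of the quartic relation other than `f` and `b * b` is a multiple of q.
  common-divisor∣b² : ∀ θ′ {d y f} → QuarticValue θ′ b (base y * base y) f → d ∣ f → d ∣ base y → d ∣ b * b
  common-divisor∣b² π/4 {d} {y} v d∣f d∣q =
    ∣m+n∣m⇒∣n (subst (d ∣_) (sym v) (∣m⇒∣m*n (base y * base y + 2 * b) d∣Q)) d∣f
    where d∣Q = ∣m⇒∣m*n (base y) d∣q
  common-divisor∣b² 3π/4 {d} {y} v d∣f d∣q =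
    ∣m+n∣m⇒∣n (subst (d ∣_) (+-comm (b * b) (2 * b * (base y * base y))) (∣m+n∣m⇒∣n (subst (d ∣_) (sym v) (∣m⇒∣m*n (base y * base y) d∣Q)) d∣f))
              (∣-trans d∣Q (n∣m*n (2 * b)))
    where d∣Q = ∣m⇒∣m*n (base y) d∣q

  value⊥base : ∀ y → Coprime (value y) (base y)
  value⊥base y (d∣f , d∣q) = coprime-* (value⊥b y) (value⊥b y)
    (d∣f , common-divisor∣b² θ {y = y} (quarticValue y) d∣f d∣q)

  -- The recursion qᵢ₊₁ = qᵢfᵢ is carried out on y instead of q: the second clause solves 1 + b(1 +
  -- y′) = (1 + b(1 + y))(1 + bg) for y′, where g = `cofactor y`.
  index : ℕ → ℕ
  index zero    = 0
  index (suc i) = y + cofactor y + b * (1 + y) * cofactor y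
    where y = index i

  base-step : ∀ i → base (index (suc i)) ≡ base (index i) * value (index i)
  base-step i = identity b (index i) (cofactor (index i))
    where
    identity : ∀ b y g → 1 + b * (1 + (y + g + b * (1 + y) * g)) ≡ (1 + b * (1 + y)) * (1 + b * g)
    identity = solve-∀

  value∣later-base : ∀ {i j} → i < j → value (index i) ∣ base (index j)
  value∣later-base {i} {suc j} (s≤s i≤j) with m≤n⇒m<n∨m≡n i≤j
  ... | inj₁ i<j  = subst (value (index i) ∣_) (sym (base-step j)) (∣m⇒∣m*n (value (index j)) (value∣later-base i<j))
  ... | inj₂ refl = subst (value (index i) ∣_) (sym (base-step j)) (n∣m*n (base (index j)))

  -- The earlier value has been absorbed into the later base, to which the later value is coprime.
  earlier⊥later : ∀ {i j} → i < j → Coprime (value (index i)) (value (index j))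
  earlier⊥later i<j (d∣fᵢ , d∣fⱼ) = value⊥base _ (d∣fⱼ , ∣-trans d∣fᵢ (value∣later-base i<j))

  pairwise-coprime : ∀ {i j} → i ≢ j → Coprime (value (index i)) (value (index j))
  pairwise-coprime {i} {j} i≢j with <-cmp i j
  ... | tri< i<j _ _ = earlier⊥later i<j
  ... | tri≈ _ i≡j _ = contradiction i≡j i≢j
  ... | tri> _ _ j<i = coprime-sym (earlier⊥later j<i)

-- The residue class and inequivalence modulo squares

a+km≡a-mod : ∀ a m k → a + k * m ≡ a mod m
a+km≡a-mod a m k = divides k (begin
  ∣ + (a + k * m) ℤ.- + a ∣   ≡⟨ cong ∣_∣ (ℤₚ.m-n≡m⊖n (a + k * m) a) ⟩
  ∣ (a + k * m) ℤ.⊖ a ∣       ≡⟨ cong ∣_∣ (ℤₚ.⊖-≥ (m≤m+n a (k * m))) ⟩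
  a + k * m ∸ a               ≡⟨ m+n∸m≡n a (k * m) ⟩
  k * m                       ∎)
  where open ≡-Reasoning

-- Equal numbers are equivalent modulo squares, so pairwise inequivalence already makes the sequence
-- injective and its set of values infinite.
theorem5p2 : (θ : Angle) (m a : ℕ) → 1 < m → Σ[ n ∈ (ℕ → ℕ) ] ((∀ i → (n i ≡ a mod m) × IsCongruentNumber θ (n i)) × (∀ i j → i ≢ j → ¬ (ℕ→ℚ (n i) ∼□ ℕ→ℚ (n j))))
theorem5p2 θ m@(suc μ) a 1<m = n , (λ i → congruence i , congruent i) , inequivalent
  where
  a⁺ β : ℕ
  a⁺ = a + m
  instance
    a⁺≢0 : NonZero a⁺
    a⁺≢0 = >-nonZero (≤-trans z<s (m≤n+m m a))
    b≢0 : NonZero (a⁺ * (m * m))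
    b≢0 = m*n≢0 a⁺ (m * m)
  -- `CoprimeValues` has `b` = `suc β`, which is not definitionally `a⁺ * (m * m)`; `b≡` translates
  -- between the two.
  β = pred (a⁺ * (m * m))
  open CoprimeValues θ β
  b≡ : b ≡ a⁺ * (m * m)
  b≡ = suc-pred (a⁺ * (m * m))
  f : ℕ → ℕ
  f i = value (index i)
  n : ℕ → ℕ
  n i = a⁺ * f i
  congruence : ∀ i → n i ≡ a mod m
  congruence i = subst (_≡ a mod m) (sym (trans (cong (λ z → a⁺ * (1 + z * g)) b≡) (identity a m g)))
    -- In the quotient, 1 accounts for the shift from `a` to `a⁺` and the rest for the multiple of
    -- `b` in the value.
    (a+km≡a-mod a m (1 + a⁺ * a⁺ * m * g))
    where
    g = cofactor (index i)
    identity : ∀ a m g → (a + m) * (1 + (a + m) * (m * m) * g) ≡ a + (1 + (a + m) * (a + m) * m * g) * m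
    identity = solve-∀
  congruent : ∀ i → IsCongruentNumber θ (n i)
  congruent i = quartic-congruent θ a⁺ m (base (index i)) (f i)
    (subst (λ z → QuarticValue θ z (base (index i) * base (index i)) (f i)) b≡ (quarticValue (index i)))
  inequivalent : ∀ i j → i ≢ j → ¬ (ℕ→ℚ (n i) ∼□ ℕ→ℚ (n j))
  inequivalent i j i≢j nᵢ∼nⱼ with ∼□⇒coprime-witness {n i} {n j} nᵢ∼nⱼ
  -- Both numbers carry the factor `a⁺`; cancelling it leaves a relation between the coprime values
  -- alone, which makes `f i` the square of `x`.
  ... | x , y , x⊥y , eq = value-nonsquare (index i) x
    (coprime-same-class⇒square (pairwise-coprime i≢j) x⊥y (*-cancelˡ-≡ _ _ a⁺ (begin
      a⁺ * (f i * (y * y))   ≡⟨ *-assoc a⁺ (f i) (y * y) ⟨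
      n i * (y * y)          ≡⟨ eq ⟩
      x * x * n j            ≡⟨ commute x a⁺ (f j) ⟩
      a⁺ * (x * x * f j)     ∎)))
    where
    open ≡-Reasoning
    commute : ∀ x a f → x * x * (a * f) ≡ a * (x * x * f)
    commute = solve-∀
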